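{- Let $n \in \mathbb{N}$ (a positive integer) be divisible by $12$. Then there is an oriented graph $G$ on $n$ vertices with $\delta^0(G) = 5n/12 - 1$ which does not contain the square of a Hamilton cycle.
   Context: Digraphs have no loops and have at most one edge in each direction between any pair of vertices. An oriented graph is a digraph containing no 2-cycle, i.e. there is at most one directed edge between any pair of distinct vertices. For a digraph $G$, the minimum semidegree $\delta^0(G)$ is the minimum of its minimum outdegree $\delta^+(G)$ and its minimum indegree $\delta^-(G)$. A Hamilton cycle of a digraph $G$ is a directed cycle passing through every vertex of $G$ exactly once. The square of a Hamilton cycle $C$ is the digraph obtained from $C$ by adding a directed edge from $x$ to $y$ whenever there is a directed path of length at most $2$ from $x$ to $y$ on $C$. So $G$ contains the square of a Hamilton cycle if its vertices can be cyclically ordered as $v_0, v_1, \dots, v_{n-1}$ such that $v_iv_{i+1}$ and $v_iv_{i+2}$ are edges of $G$ (directed from the first vertex to the second) for every $i$, with indices modulo $n$. -}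

module Defs where

open import Data.Fin.Base using (Fin; toℕ)
open import Data.Fin.Permutation using (Permutation′; _⟨$⟩ʳ_)
open import Data.Fin.Properties using (nonZeroIndex)
open import Data.Fin.Subset using (Subset; ∣_∣)
open import Data.List.Base using (map; allFin)
open import Data.List.Extrema.Nat using (min)
open import Data.Nat.Base using (ℕ; _+_; _⊓_)
open import Data.Nat.DivMod using (_mod_)
open import Data.Product.Base using (_×_; Σ-syntax)
open import Data.Vec.Base using (tabulate)
open import Level using (0ℓ)
open import Relation.Binary.Core using (Rel)
open import Relation.Binary.Definitions using (Asymmetric; Decidable; Irreflexive)
open import Relation.Binary.PropositionalEquality.Core using (_≡_)
open import Relation.Nullary.Decidable.Core using (does)

-- Only the truth value of u ⟶ v matters below, so there is at most one edge
-- in each direction; 2-cycles are allowed.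
record Digraph (n : ℕ) : Set₁ where
  infix 4 _⟶_ _⟶?_
  field
    _⟶_     : Rel (Fin n) 0ℓ
    _⟶?_    : Decidable _⟶_
    loopless : Irreflexive _≡_ _⟶_

module _ {n : ℕ} (G : Digraph n) where
  open Digraph G

  IsOriented : Set
  IsOriented = Asymmetric _⟶_

  N⁺ N⁻ : Fin n → Subset n
  N⁺ u = tabulate (λ v → does (u ⟶? v))
  N⁻ u = tabulate (λ v → does (v ⟶? u))

  outdegree indegree : Fin n → ℕ
  outdegree u = ∣ N⁺ u ∣
  indegree  u = ∣ N⁻ u ∣

  -- `min` needs a default value. As no degree exceeds n, the default n does
  -- not affect the minimum when n > 0.
  δ⁺ δ⁻ δ⁰ : ℕ
  δ⁺ = min n (map outdegree (allFin n))
  δ⁻ = min n (map indegree  (allFin n))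
  δ⁰ = δ⁺ ⊓ δ⁻

-- Addition of indices modulo n.
infixl 6 _⊕_
_⊕_ : ∀ {n} → Fin n → ℕ → Fin n
_⊕_ {n} i k = _mod_ (toℕ i + k) n {{nonZeroIndex i}}

-- The cyclic ordering v₀, …, vₙ₋₁ of the vertices is given by a permutation.
ContainsSquareOfHamiltonCycle : ∀ {n} → Digraph n → Set
ContainsSquareOfHamiltonCycle {n} G =
  Σ[ σ ∈ Permutation′ n ] let v = σ ⟨$⟩ʳ_ in
    ∀ i → (v i ⟶ v (i ⊕ 1)) × (v i ⟶ v (i ⊕ 2))
  where open Digraph G

-- Let H be the lexicographic product C₃[C₄]: an oriented graph on 12 classes,
-- regular of in- and outdegree 5. Blow up each class to k vertices, where n = 12k,
-- and then move one vertex from class 1 to class 2. All semidegrees were 5k; they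
-- drop by at most 1, and outdegrees in class 0 do drop. Classes 0, 2 (called a) and
-- 1, 3 (called b) form one part of C₃. In the square of a Hamilton cycle, the
-- vertices visited in this part come in runs of two, one in a and one in b: a longer
-- run would need a transitive triangle within C₄, and a shorter one an edge of C₃
-- that reverses the cyclic order. But there are 2k + 1 vertices in a and only 2k − 1
-- in b.
module Submission where

open import Defs
open import Data.Bool.Base using (Bool; true; false)
open import Data.Empty using (⊥-elim)
open import Data.Fin.Base using (Fin; zero; suc; toℕ; combine; quotient; remainder; _↑ˡ_; _↑ʳ_)
open import Data.Fin.Patterns using (0F; 1F)
open import Data.Fin.Permutation using (Permutation′; _⟨$⟩ʳ_; _⟨$⟩ˡ_; inverseˡ; inverseʳ)
open import Data.Fin.Properties
  using (_≟_; all?; any?; suc-injective; <⇒≢; toℕ<n; toℕ-injective; toℕ-fromℕ<;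
         splitAt-↑ˡ; splitAt-↑ʳ; combine-injective; combine-remQuot; remQuot-combine; pigeonhole)
open import Data.Fin.Subset using (∣_∣)
open import Data.Fin.Subset.Properties using (∣p∣≤n)
open import Data.List.Base using (allFin)
open import Data.List.Extrema.Nat using (min≤v⁺; v≤min⁺)
open import Data.List.Membership.Propositional using (lose)
open import Data.List.Membership.Propositional.Properties using (∈-allFin)
open import Data.List.Relation.Unary.All using (universal)
import Data.List.Relation.Unary.All.Properties as All
import Data.List.Relation.Unary.Any.Properties as Any
open import Data.Nat.Base using (ℕ; zero; suc; _+_; _≤_; z≤n; s≤s; NonZero; _*_; _∸_; _/_; _%_; ≢-nonZero⁻¹)
open import Data.Nat.Divisibility.Core using (_∣_; divides-refl)
open import Data.Nat.DivMod using (m<n⇒m%n≡m; [m+n]%n≡m%n; m%n%n≡m%n; m%n<n; %-distribˡ-+; m*n/n≡m)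
open import Data.Nat.Properties
  using (+-assoc; +-comm; +-monoˡ-≤; *-assoc; *-comm; m≤n+m; m≤n+o⇒m∸n≤o; n<1+n; ≤-antisym;
         ≤-reflexive; ≤-trans; ⊓-glb; m≤n⇒m⊓o≤n; module ≤-Reasoning; +-commutativeSemigroup)
  renaming (_≟_ to _≟ℕ_)
open import Data.Product.Base using (Σ-syntax; ∃; _×_; _,_; proj₁; proj₂)
open import Data.Sum.Base using (_⊎_; inj₂; [_,_]′)
open import Data.Vec.Base using (tabulate)
open import Data.Vec.Functional using (updateAt)
open import Data.Vec.Functional.Properties using (updateAt-updates; updateAt-minimal)
open import Data.Vec.Properties using (tabulate-cong)
open import Function.Base using (_∘_; const; flip; id)
open import Relation.Binary.Definitions using (Asymmetric; Decidable)
open import Relation.Binary.PropositionalEquality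
  using (_≡_; _≢_; refl; sym; trans; cong; cong₂; subst; module ≡-Reasoning)
open import Relation.Nullary.Decidable using (Dec; yes; no; does; from-yes; _×-dec_; _⊎-dec_; _→-dec_; ¬?)
open import Relation.Nullary.Negation.Core using (¬_; contradiction)

open import Algebra.Properties.CommutativeSemigroup +-commutativeSemigroup using (x∙yz≈y∙xz)

private
  variable
    m n : ℕ

-- Counting the true values of Boolean functions on `Fin n`

bit : Bool → ℕ
bit true  = 1
bit false = 0

bit≤1 : ∀ b → bit b ≤ 1
bit≤1 true  = s≤s z≤n
bit≤1 false = z≤n

count : (Fin n → Bool) → ℕ
count f = ∣ tabulate f ∣

count-cong : {f g : Fin n → Bool} → (∀ i → f i ≡ g i) → count f ≡ count g
count-cong f≗g = cong ∣_∣ (tabulate-cong f≗g)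

count-suc : ∀ (f : Fin (suc n) → Bool) → count f ≡ bit (f zero) + count (f ∘ suc)
count-suc f with f zero
... | true  = refl
... | false = refl

count-+ : ∀ m (f : Fin (m + n) → Bool) → count f ≡ count (f ∘ (_↑ˡ n)) + count (f ∘ (m ↑ʳ_))
count-+     zero       f = refl
count-+ {n} (suc m) f = begin
  count f
    ≡⟨ count-suc f ⟩
  bit (f zero) + count (f ∘ suc)
    ≡⟨ cong (bit (f zero) +_) (count-+ m (f ∘ suc)) ⟩
  bit (f zero) + (count (left ∘ suc) + count right)
    ≡⟨ +-assoc (bit (f zero)) (count (left ∘ suc)) (count right) ⟨
  bit (f zero) + count (left ∘ suc) + count right
    ≡⟨ cong (_+ count right) (count-suc left) ⟨
  count left + count right ∎
  where
  open ≡-Reasoning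
  left  = f ∘ (_↑ˡ n)
  right = f ∘ (suc m ↑ʳ_)

remainder-↑ˡ : ∀ k (i : Fin m) → remainder {suc k} m (i ↑ˡ k * m) ≡ i
remainder-↑ˡ {m} k i rewrite splitAt-↑ˡ m i (k * m) = refl

remainder-↑ʳ : ∀ k m (i : Fin (k * m)) → remainder {suc k} m (m ↑ʳ i) ≡ remainder {k} m i
remainder-↑ʳ k m i rewrite splitAt-↑ʳ m (k * m) i = refl

-- `remainder` runs through `Fin m` once in each of the `k` blocks. This is how blowing up
-- multiplies degrees by `k`.
count-remainder : ∀ k (f : Fin m → Bool) → count (f ∘ remainder {k} m) ≡ k * count f
count-remainder     zero    f = refl
count-remainder {m} (suc k) f = trans (count-+ m (f ∘ remainder {suc k} m)) (cong₂ _+_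
  (count-cong (cong f ∘ remainder-↑ˡ k))
  (trans (count-cong (cong f ∘ remainder-↑ʳ k m)) (count-remainder k f)))

-- Both sides equal the count away from `x` plus the two bits at `x`. Adding a bit on each side
-- avoids truncated subtraction.
count-agreeOff : ∀ (f g : Fin n → Bool) x → (∀ y → y ≢ x → f y ≡ g y) →
  bit (g x) + count f ≡ bit (f x) + count g
count-agreeOff f g zero f≗g = begin
  bit (g zero) + count f
    ≡⟨ cong (bit (g zero) +_) (count-suc f) ⟩
  bit (g zero) + (bit (f zero) + count (f ∘ suc))
    ≡⟨ x∙yz≈y∙xz (bit (g zero)) (bit (f zero)) (count (f ∘ suc)) ⟩
  bit (f zero) + (bit (g zero) + count (f ∘ suc))
    ≡⟨ cong (λ c → bit (f zero) + (bit (g zero) + c)) (count-cong (λ y → f≗g (suc y) λ ())) ⟩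
  bit (f zero) + (bit (g zero) + count (g ∘ suc))
    ≡⟨ cong (bit (f zero) +_) (count-suc g) ⟨
  bit (f zero) + count g ∎
  where open ≡-Reasoning
count-agreeOff f g (suc x) f≗g = begin
  bit (g (suc x)) + count f
    ≡⟨ cong (bit (g (suc x)) +_) (count-suc f) ⟩
  bit (g (suc x)) + (bit (f zero) + count (f ∘ suc))
    ≡⟨ x∙yz≈y∙xz (bit (g (suc x))) (bit (f zero)) (count (f ∘ suc)) ⟩
  bit (f zero) + (bit (g (suc x)) + count (f ∘ suc))
    ≡⟨ cong₂ (λ b c → bit b + c) (f≗g zero λ ())
         (count-agreeOff (f ∘ suc) (g ∘ suc) x λ y y≢x → f≗g (suc y) (y≢x ∘ suc-injective)) ⟩
  bit (g zero) + (bit (f (suc x)) + count (g ∘ suc))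
    ≡⟨ x∙yz≈y∙xz (bit (g zero)) (bit (f (suc x))) (count (g ∘ suc)) ⟩
  bit (f (suc x)) + (bit (g zero) + count (g ∘ suc))
    ≡⟨ cong (bit (f (suc x)) +_) (count-suc g) ⟨
  bit (f (suc x)) + count g ∎
  where open ≡-Reasoning

-- Evaluating the minimum semidegree

δ⁰≡ : (G : Digraph n) {d : ℕ} → (∀ u → d ≤ outdegree G u) → (∀ u → d ≤ indegree G u) →
  ∀ u → outdegree G u ≤ d → δ⁰ G ≡ d
δ⁰≡ {n} G {d} d≤out d≤in u out≤d = ≤-antisym
  (m≤n⇒m⊓o≤n _ (min≤v⁺ n _ (inj₂ (Any.map⁺ (lose (∈-allFin u) out≤d)))))
  (⊓-glb (v≤min⁺ d≤n (All.map⁺ (universal d≤out (allFin n))))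
         (v≤min⁺ d≤n (All.map⁺ (universal d≤in  (allFin n)))))
  where
  -- `min` takes its default `n` into account, so the lower bound `d` has to hold for `n` as well.
  d≤n : d ≤ n
  d≤n = ≤-trans (d≤out u) (∣p∣≤n (N⁺ G u))

-- Cyclic arithmetic of indices

toℕ-⊕ : ∀ (i : Fin (suc m)) a → toℕ (i ⊕ a) ≡ (toℕ i + a) % suc m
toℕ-⊕ {m} i a = toℕ-fromℕ< (m%n<n (toℕ i + a) (suc m))

⊕-⊕ : ∀ (i : Fin n) a b → (i ⊕ a) ⊕ b ≡ i ⊕ (a + b)
⊕-⊕ {n@(suc _)} i a b = toℕ-injective (begin
  toℕ ((i ⊕ a) ⊕ b)                 ≡⟨ toℕ-⊕ (i ⊕ a) b ⟩
  (toℕ (i ⊕ a) + b) % n             ≡⟨ cong (λ t → (t + b) % n) (toℕ-⊕ i a) ⟩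
  ((toℕ i + a) % n + b) % n         ≡⟨ %-distribˡ-+ ((toℕ i + a) % n) b n ⟩
  ((toℕ i + a) % n % n + b % n) % n ≡⟨ cong (λ t → (t + b % n) % n) (m%n%n≡m%n (toℕ i + a) n) ⟩
  ((toℕ i + a) % n + b % n) % n     ≡⟨ %-distribˡ-+ (toℕ i + a) b n ⟨
  (toℕ i + a + b) % n               ≡⟨ cong (_% n) (+-assoc (toℕ i) a b) ⟩
  (toℕ i + (a + b)) % n             ≡⟨ toℕ-⊕ i (a + b) ⟨
  toℕ (i ⊕ (a + b))                 ∎)
  where open ≡-Reasoning

⊕-n : ∀ (i : Fin n) → i ⊕ n ≡ i
⊕-n {n@(suc _)} i = toℕ-injective (begin
  toℕ (i ⊕ n)     ≡⟨ toℕ-⊕ i n ⟩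
  (toℕ i + n) % n ≡⟨ [m+n]%n≡m%n (toℕ i) n ⟩
  toℕ i % n       ≡⟨ m<n⇒m%n≡m (toℕ<n i) ⟩
  toℕ i           ∎)
  where open ≡-Reasoning

pre : Fin n → Fin n
pre {n} i = i ⊕ (n ∸ 1)

pre-⊕1 : ∀ (i : Fin n) → pre i ⊕ 1 ≡ i
pre-⊕1 {suc n} i = trans (⊕-⊕ i n 1) (trans (cong (i ⊕_) (+-comm n 1)) (⊕-n i))

pre-⊕2 : ∀ (i : Fin n) → pre i ⊕ 2 ≡ i ⊕ 1
pre-⊕2 i = trans (sym (⊕-⊕ (pre i) 1 1)) (cong (_⊕ 1) (pre-⊕1 i))

⊕1-pre : ∀ (i : Fin n) → pre (i ⊕ 1) ≡ i
⊕1-pre {suc n} i = trans (⊕-⊕ i 1 n) (⊕-n i)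

-- The oriented graph C₃[C₄] on twelve classes

infix 4 _⇒_ _⇒?_

part : Fin 12 → Fin 3
part = quotient 4

position : Fin 12 → Fin 4
position = remainder {3} 4

_⇒_ : Fin 12 → Fin 12 → Set
r ⇒ s = part s ≡ part r ⊕ 1 ⊎ part s ≡ part r × position s ≡ position r ⊕ 1

_⇒?_ : Decidable _⇒_
r ⇒? s = part s ≟ part r ⊕ 1 ⊎-dec part s ≟ part r ×-dec position s ≟ position r ⊕ 1

⇒-asym : Asymmetric _⇒_
⇒-asym {r} {s} = from-yes (all? λ r → all? λ s → (r ⇒? s) →-dec ¬? (s ⇒? r)) r s

-- The five are the four classes of the next part and the one successor on the same C₄.
⇒-outregular : ∀ r → count (λ s → does (r ⇒? s)) ≡ 5
⇒-outregular = from-yes (all? λ r → count (λ s → does (r ⇒? s)) ≟ℕ 5)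

⇒-inregular : ∀ r → count (λ s → does (s ⇒? r)) ≡ 5
⇒-inregular = from-yes (all? λ r → count (λ s → does (s ⇒? r)) ≟ℕ 5)

-- The position on C₄ is `2t` for `a` and `2t + 1` for `b`. The index in `Fin 2` serves later to
-- enumerate the vertices of these classes.
a b : Fin 2 → Fin 12
a t = combine {3} 0F (combine {2} {2} t 0F)
b t = combine {3} 0F (combine {2} {2} t 1F)

a-injective : ∀ {t u} → a t ≡ a u → t ≡ u
a-injective {t} {u} = from-yes (all? λ t → all? λ u → (a t ≟ a u) →-dec (t ≟ u)) t u

a≢b : ∀ t u → a t ≢ b u
a≢b = from-yes (all? λ t → all? λ u → ¬? (a t ≟ b u))

A B : Fin 12 → Set
A r = ∃ λ t → r ≡ a t
B r = ∃ λ t → r ≡ b t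

B? : ∀ r → Dec (B r)
B? r = any? λ t → r ≟ b t

-- The `A` classes are at positions 0 and 2 of one C₄, which are opposite there.
A-independent : ∀ {r s} → A r → A s → ¬ r ⇒ s
A-independent (t , refl) (u , refl) = from-yes (all? λ t → all? λ u → ¬? (a t ⇒? a u)) t u

-- On C₄ both neighbours of an `A` class are `B` classes. So if neither `p` nor `s` is in `B`, then
-- `p` lies in the previous part and `s` in the next one, and `p ⇒ s` would go against the cyclic
-- order of C₃.
triangle-through-A : ∀ {p r s} → A r → p ⇒ r → r ⇒ s → p ⇒ s → B s ⊎ B p
triangle-through-A {p} {_} {s} (t , refl) =
  from-yes (all? λ t → all? λ p → all? λ s →
    (p ⇒? a t) →-dec (a t ⇒? s) →-dec (p ⇒? s) →-dec (B? s ⊎-dec B? p)) t p s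

-- Pairing A with B along the square of a cycle

module Partner (w : Fin n → Fin 12)
               (w⇒₁ : ∀ i → w i ⇒ w (i ⊕ 1)) (w⇒₂ : ∀ i → w i ⇒ w (i ⊕ 2)) where

  -- In the `no` case the predecessor is chosen unchecked; `partner-B` justifies this when `w i` is
  -- in `A`.
  partner : Fin n → Fin n
  partner i with B? (w (i ⊕ 1))
  ... | yes _ = i ⊕ 1
  ... | no  _ = pre i

  partner-B : ∀ i → A (w i) → B (w (partner i))
  partner-B i wi∈A with B? (w (i ⊕ 1))
  ... | yes w∈B = w∈B
  ... | no  w∉B = [ flip contradiction w∉B , id ]′
    (triangle-through-A wi∈A
      (subst (λ j → w (pre i) ⇒ w j) (pre-⊕1 i) (w⇒₁ (pre i)))
      (w⇒₁ i)
      -- The chord of the square that skips `i` closes the triangle on `pre i`, `i` and `i ⊕ 1`.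
      (subst (λ j → w (pre i) ⇒ w j) (pre-⊕2 i) (w⇒₂ (pre i))))

  A-not-two-apart : ∀ i j → A (w i) → A (w j) → i ⊕ 1 ≢ pre j
  A-not-two-apart i j wi∈A wj∈A i+1≡j-1 =
    A-independent wi∈A wj∈A (subst (λ j → w i ⇒ w j) i+2≡j (w⇒₂ i))
    where
    i+2≡j : i ⊕ 2 ≡ j
    i+2≡j = trans (sym (⊕-⊕ i 1 1)) (trans (cong (_⊕ 1) i+1≡j-1) (pre-⊕1 j))

  -- Shifts by one are injective, so a collision must join the successor of one index with the
  -- predecessor of the other. The two are then joined by a chord of the square, an edge inside `A`.
  partner-injective : ∀ i j → A (w i) → A (w j) → partner i ≡ partner j → i ≡ j
  partner-injective i j wi∈A wj∈A eq with B? (w (i ⊕ 1)) | B? (w (j ⊕ 1))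
  ... | yes _ | yes _ = trans (sym (⊕1-pre i)) (trans (cong pre eq) (⊕1-pre j))
  ... | yes _ | no  _ = contradiction eq (A-not-two-apart i j wi∈A wj∈A)
  ... | no  _ | yes _ = contradiction (sym eq) (A-not-two-apart j i wj∈A wi∈A)
  ... | no  _ | no  _ = trans (sym (pre-⊕1 i)) (trans (cong (_⊕ 1) eq) (pre-⊕1 j))

-- The copy j₀ witnesses k > 0; writing suc _ for k instead would let Fin (k * 12)
-- unfold in every conversion check, which is prohibitively slow.
module Construction {k : ℕ} (j₀ : Fin k) where

  -- The blow-up with one vertex moved, and its degrees

  class₀ class : Fin (k * 12) → Fin 12
  class₀ = remainder {k} 12

  moved : Fin (k * 12)
  moved = combine {k} j₀ (b 0F)

  class = updateAt class₀ moved (const (a 1F))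

  class₀-combine : ∀ (j : Fin k) r → class₀ (combine j r) ≡ r
  class₀-combine j r = cong proj₂ (remQuot-combine {k} j r)

  class-moved : class moved ≡ a 1F
  class-moved = updateAt-updates moved class₀

  class-unmoved : ∀ v → v ≢ moved → class v ≡ class₀ v
  class-unmoved v v≢moved = updateAt-minimal v moved class₀ v≢moved

  G : Digraph (k * 12)
  G = record
    { _⟶_      = λ u v → class u ⇒ class v
    ; _⟶?_     = λ u v → class u ⇒? class v
    ; loopless = λ { {u} refl u⇒u → ⇒-asym {class u} {class u} u⇒u u⇒u }
    }

  G-oriented : IsOriented G
  G-oriented {u} {v} = ⇒-asym {class u} {class v}

  -- For `f` the in- or out-neighbourhood of a class, this computes a degree in `G`: `k * 5`, less
  -- one if `f` holds at `b 0F`, plus one if it holds at `a 1F`.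
  count-class : ∀ (f : Fin 12 → Bool) → count f ≡ 5 →
    bit (f (a 1F)) + k * 5 ≡ bit (f (b 0F)) + count (f ∘ class)
  count-class f count≡5 = begin
    bit (f (a 1F)) + k * 5
      ≡⟨ cong₂ (λ r c → bit (f r) + c) class-moved (trans (count-remainder k f) (cong (k *_) count≡5)) ⟨
    bit (f (class moved)) + count (f ∘ class₀)
      ≡⟨ count-agreeOff (f ∘ class₀) (f ∘ class) moved
           (λ v v≢moved → cong f (sym (class-unmoved v v≢moved))) ⟩
    bit (f (class₀ moved)) + count (f ∘ class)
      ≡⟨ cong (λ r → bit (f r) + count (f ∘ class)) (class₀-combine j₀ (b 0F)) ⟩
    bit (f (b 0F)) + count (f ∘ class) ∎
    where open ≡-Reasoning

  count-class-≥ : ∀ (f : Fin 12 → Bool) → count f ≡ 5 → k * 5 ∸ 1 ≤ count (f ∘ class)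
  count-class-≥ f count≡5 = m≤n+o⇒m∸n≤o (k * 5) 1 (begin
    k * 5                              ≤⟨ m≤n+m (k * 5) (bit (f (a 1F))) ⟩
    bit (f (a 1F)) + k * 5             ≡⟨ count-class f count≡5 ⟩
    bit (f (b 0F)) + count (f ∘ class) ≤⟨ +-monoˡ-≤ (count (f ∘ class)) (bit≤1 (f (b 0F))) ⟩
    1 + count (f ∘ class)              ∎)
    where open ≤-Reasoning

  class-combine-a : ∀ j t → class (combine j (a t)) ≡ a t
  class-combine-a j t = trans (class-unmoved _ unmoved) (class₀-combine j (a t))
    where
    unmoved : combine j (a t) ≢ moved
    unmoved eq = a≢b t 0F (proj₂ (combine-injective j (a t) j₀ (b 0F) eq))

  outdegree-a₀ : outdegree G (combine j₀ (a 0F)) ≡ k * 5 ∸ 1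
  outdegree-a₀ = trans
    (cong (λ r → count (λ v → does (r ⇒? class v))) (class-combine-a j₀ 0F))
    -- There is an edge from `a 0F` to `b 0F` but none to `a 1F`, so the bits compute to 1 and 0.
    (cong (_∸ 1) (sym (count-class (λ s → does (a 0F ⇒? s)) (⇒-outregular (a 0F)))))

  δ⁰≡5k∸1 : δ⁰ G ≡ k * 5 ∸ 1
  δ⁰≡5k∸1 = δ⁰≡ G
    (λ u → count-class-≥ (λ s → does (class u ⇒? s)) (⇒-outregular (class u)))
    (λ u → count-class-≥ (λ s → does (s ⇒? class u)) (⇒-inregular (class u)))
    (combine j₀ (a 0F)) (≤-reflexive outdegree-a₀)

  -- Counting the vertices in A and in B

  a-vertex : Fin (suc (k * 2)) → Fin (k * 12)
  -- The moved vertex joins the 2k vertices that were in `A` from the start.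
  a-vertex zero    = moved
  a-vertex (suc e) = combine {k} (quotient 2 e) (a (remainder {k} 2 e))

  class-a-vertex : ∀ e → A (class (a-vertex e))
  class-a-vertex zero    = 1F , class-moved
  class-a-vertex (suc e) = remainder {k} 2 e , class-combine-a (quotient 2 e) (remainder {k} 2 e)

  a-vertex-injective : ∀ e e′ → a-vertex e ≡ a-vertex e′ → e ≡ e′
  a-vertex-injective zero    zero     eq = refl
  -- As a pair of copy and original class, `moved` still has second component `b 0F`.
  a-vertex-injective zero    (suc e′) eq =
    contradiction (sym (proj₂ (combine-injective {k} j₀ (b 0F) _ _ eq))) (a≢b (remainder {k} 2 e′) 0F)
  a-vertex-injective (suc e) zero     eq =
    contradiction (proj₂ (combine-injective {k} _ _ j₀ (b 0F) eq)) (a≢b (remainder {k} 2 e) 0F)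
  a-vertex-injective (suc e) (suc e′) eq with combine-injective {k} _ _ _ _ eq
  ... | q≡q′ , ar≡ar′ = cong suc (trans (sym (combine-remQuot {k} 2 e))
    (trans (cong₂ (combine {k}) q≡q′ (a-injective {remainder {k} 2 e} {remainder {k} 2 e′} ar≡ar′))
           (combine-remQuot {k} 2 e′)))

  -- No vertex is moved into a `B` class, so a vertex of class `b t` has kept its original class and
  -- is determined by its copy and `t`.
  class-b : ∀ v ((t , _) : B (class v)) → combine {k} (quotient 12 v) (b t) ≡ v
  class-b v (t , v∈b) = trans
    (cong (combine {k} (quotient 12 v)) (trans (sym v∈b) (class-unmoved v unmoved)))
    (combine-remQuot {k} 12 v)
    where
    unmoved : v ≢ moved
    unmoved refl = a≢b 1F t (trans (sym class-moved) v∈b)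

  module _ (square : ContainsSquareOfHamiltonCycle G) where

    σ : Permutation′ (k * 12)
    σ = proj₁ square

    w : Fin (k * 12) → Fin 12
    w i = class (σ ⟨$⟩ʳ i)

    open Partner w (proj₁ ∘ proj₂ square) (proj₂ ∘ proj₂ square)

    index : Fin (suc (k * 2)) → Fin (k * 12)
    index e = σ ⟨$⟩ˡ a-vertex e

    w-index : ∀ e → A (w (index e))
    w-index e = subst (A ∘ class) (sym (inverseʳ σ)) (class-a-vertex e)

    index-injective : ∀ e e′ → index e ≡ index e′ → e ≡ e′
    index-injective e e′ eq = a-vertex-injective e e′
      (trans (sym (inverseʳ σ)) (trans (cong (σ ⟨$⟩ʳ_) eq) (inverseʳ σ)))

    b-vertex : Fin (suc (k * 2)) → Fin (k * 12)
    b-vertex e = σ ⟨$⟩ʳ partner (index e)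

    class-b-vertex : ∀ e → B (class (b-vertex e))
    class-b-vertex e = partner-B (index e) (w-index e)

    b-vertex-injective : ∀ e e′ → b-vertex e ≡ b-vertex e′ → e ≡ e′
    b-vertex-injective e e′ eq = index-injective e e′
      (partner-injective (index e) (index e′) (w-index e) (w-index e′)
        (trans (sym (inverseˡ σ)) (trans (cong (σ ⟨$⟩ˡ_) eq) (inverseˡ σ))))

    -- The pair for `moved` is never attained, which leaves 2k - 1 codes; the bound 2k already falls
    -- short of the 2k + 1 vertices in `A`.
    b-code : Fin (suc (k * 2)) → Fin (k * 2)
    b-code e = combine {k} (quotient 12 (b-vertex e)) (proj₁ (class-b-vertex e))

    b-code-injective : ∀ e e′ → b-code e ≡ b-code e′ → e ≡ e′
    b-code-injective e e′ eq with combine-injective {k} _ _ _ _ eq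
    ... | q≡q′ , t≡t′ = b-vertex-injective e e′
      (trans (sym (class-b _ (class-b-vertex e)))
        (trans (cong₂ (combine {k}) q≡q′ (cong b t≡t′)) (class-b _ (class-b-vertex e′))))

  no-square : ¬ ContainsSquareOfHamiltonCycle G
  no-square square with pigeonhole (n<1+n (k * 2)) (b-code square)
  ... | e , e′ , e<e′ , eq = <⇒≢ e<e′ (b-code-injective square e e′ eq)

blowUp-of-C₃[C₄] : ∀ {k} → Fin k → Σ[ G ∈ Digraph (k * 12) ]
  (IsOriented G × δ⁰ G ≡ (5 * (k * 12)) / 12 ∸ 1 × ¬ ContainsSquareOfHamiltonCycle G)
blowUp-of-C₃[C₄] {k} j₀ = G , G-oriented , trans δ⁰≡5k∸1 (cong (_∸ 1) k*5≡5n/12) , no-square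
  where
  open Construction j₀
  open ≡-Reasoning
  k*5≡5n/12 : k * 5 ≡ (5 * (k * 12)) / 12
  k*5≡5n/12 = begin
    k * 5             ≡⟨ *-comm k 5 ⟩
    5 * k             ≡⟨ m*n/n≡m (5 * k) 12 ⟨
    5 * k * 12 / 12   ≡⟨ cong (_/ 12) (*-assoc 5 k 12) ⟩
    5 * (k * 12) / 12 ∎

proposition3 : (n : ℕ) .{{_ : NonZero n}} → 12 ∣ n →
    Σ[ G ∈ Digraph n ]
    (IsOriented G × δ⁰ G ≡ (5 * n) / 12 ∸ 1 × ¬ ContainsSquareOfHamiltonCycle G)
proposition3 .(zero * 12)  (divides-refl zero)    = ⊥-elim (≢-nonZero⁻¹ 0 refl)
proposition3 .(suc k * 12) (divides-refl (suc k)) = blowUp-of-C₃[C₄] {suc k} 0F
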